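{- Let $1\le l\le m\le n$ be integers and let $1\le k\le n-l+1$. The number of parking functions $\pi\in\mathrm{PF}(m,n)$ with $\pi_1=k,\ \pi_2=k+1,\ \dots,\ \pi_l=k+l-1$ is $$(n-m+1)\sum_{s=0}^{\min(n-k-l+1,\,m-l)}\binom{m-l}{s}(n-s+1-l)^{m-s-l-1}\,l\,(s+l)^{s-1}.$$ Moreover, this quantity is constant in $k$ for $k\le n-m+1$ and decreases as $k$ increases past $n-m+1$.
   Context: Write $[n]=\{1,\dots,n\}$. For integers $0\le m\le n$, $\mathrm{PF}(m,n)$ denotes the set of parking functions with $m$ cars and $n$ spots: sequences $(\pi_1,\dots,\pi_m)\in[n]^m$ such that, when cars $1,\dots,m$ enter in order a one-way street with spots $1,\dots,n$ and car $i$ parks in spot $\pi_i$ if it is free and otherwise in the first free spot after $\pi_i$, all cars park. Equivalently, the non-decreasing rearrangement $(\lambda_1,\dots,\lambda_m)$ satisfies $\lambda_i\le n-m+i$ for all $i$. Powers with exponent $-1$ are taken in $\mathbb Q$. -}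

module Defs where

open import Algebra.Definitions.RawMonoid using (sum)
import Algebra.Definitions.RawSemiring as RawSemiring
open import Data.Fin.Base using (Fin; zero; suc; toℕ)
open import Data.Fin.Properties using (all?)
open import Data.Fin.Subset using (Subset; inside; outside; ⊥)
open import Data.Integer.Base as ℤ using (ℤ; +_; -[1+_]; +0; +[1+_])
open import Data.List.Base using (List; []; _∷_; length; filter; allFin; cartesianProductWith)
open import Data.Maybe.Base using (Maybe; just; nothing; map; _>>=_)
open import Data.Maybe using (Is-just)
import Data.Maybe.Relation.Unary.Any as Maybe
open import Data.Nat.Base as ℕ using (ℕ; zero; suc; _<_; _∸_; _⊓_)
open import Data.Nat.Combinatorics using (_C_)
import Data.Nat.Properties as ℕ
open import Data.Rational.Base as ℚ using (ℚ; mkℚ; 0ℚ; _*_; _/_; 1/_; +-0-rawMonoid; +-*-rawSemiring)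
open import Data.Unit.Base using (tt)
open import Data.Vec.Base using (Vec; []; _∷_; lookup)
open import Relation.Binary.PropositionalEquality using (_≡_)
open import Relation.Nullary.Decidable using (yes; _×-dec_; _→-dec_)
open import Relation.Unary using (Pred; Decidable)

-- Spots and cars are indexed from 0: the element i of Fin n is spot i + 1 of
-- the street, and position j of a vector holds the preference of car j + 1.
-- A subset of Fin n records the occupied spots.

-- The occupied spots after a car with the given preference has taken the first
-- free spot at or after it; nothing if there is no such spot.
park : ∀ {n} → Subset n → Fin n → Maybe (Subset n)
park (x ∷ occ)          (suc i) = map (x ∷_) (park occ i)
park (outside ∷ occ)    zero    = just (inside ∷ occ)
park (inside ∷ [])      zero    = nothing
park (inside ∷ y ∷ occ) zero    = map (inside ∷_) (park (y ∷ occ) zero)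

parkAll : ∀ {m n} → Subset n → Vec (Fin n) m → Maybe (Subset n)
parkAll occ []      = just occ
parkAll occ (p ∷ π) = park occ p >>= λ occ′ → parkAll occ′ π

IsParkingFunction : ∀ {m n} → Vec (Fin n) m → Set
IsParkingFunction π = Is-just (parkAll ⊥ π)

-- π₁ = k, π₂ = k + 1, …, πₗ = k + l - 1, where the numbers are 1-based:
-- entry i + 1 of π is suc (toℕ (lookup π i)).
StartsWithRun : ∀ {m n} → ℕ → ℕ → Vec (Fin n) m → Set
StartsWithRun {m} l k π =
  (i : Fin m) → toℕ i < l → suc (toℕ (lookup π i)) ≡ k ℕ.+ toℕ i

isParkingFunction? : ∀ {m n} → Decidable (IsParkingFunction {m} {n})
isParkingFunction? π = Maybe.dec (λ _ → yes tt) (parkAll ⊥ π)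

startsWithRun? : ∀ {m n} l k → Decidable (StartsWithRun {m} {n} l k)
startsWithRun? l k π =
  all? λ i → (toℕ i ℕ.<? l) →-dec (suc (toℕ (lookup π i)) ℕ.≟ k ℕ.+ toℕ i)

-- Every element of [n]^m, each exactly once.
sequences : ∀ m n → List (Vec (Fin n) m)
sequences zero    n = [] ∷ []
sequences (suc m) n = cartesianProductWith _∷_ (allFin n) (sequences m n)

count : ∀ {m n p} {P : Pred (Vec (Fin n) m) p} → Decidable P → ℕ
count {m} {n} P? = length (filter P? (sequences m n))

#PF : (l m n k : ℕ) → ℕ
#PF l m n k =
  count {m} {n} λ π → isParkingFunction? π ×-dec startsWithRun? l k π

fromℤ : ℤ → ℚ
fromℤ i = i / 1

-- Total inverse, with the convention inv 0 = 0.
inv : ℚ → ℚ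
inv   (mkℚ +0       _ _) = 0ℚ
inv p@(mkℚ +[1+ _ ] _ _) = 1/ p
inv p@(mkℚ -[1+ _ ] _ _) = 1/ p

infixr 8 _^_
_^_ : ℚ → ℤ → ℚ
p ^ (+ e)    = RawSemiring._^_ +-*-rawSemiring p e
p ^ -[1+ e ] = RawSemiring._^_ +-*-rawSemiring (inv p) (suc e)

-- Below, l ≥ 1 and s ≤ m - l with m ≤ n, so both bases are at least 1 and the
-- convention for inv 0 plays no role.
summand : (l m n s : ℕ) → ℚ
summand l m n s =
  fromℤ (+ ((m ∸ l) C s))
  * fromℤ (+ n ℤ.- + s ℤ.+ ℤ.1ℤ ℤ.- + l) ^ (+ m ℤ.- + s ℤ.- + l ℤ.- ℤ.1ℤ)
  * fromℤ (+ l)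
  * fromℤ (+ s ℤ.+ + l) ^ (+ s ℤ.- ℤ.1ℤ)

-- The upper limit of summation n - k - l + 1 is written (n + 1) ∸ (k + l): it is
-- nonnegative for k ≤ n - l + 1, while n - k - l may be -1.
formula : (l m n k : ℕ) → ℚ
formula l m n k =
  fromℤ (+ n ℤ.- + m ℤ.+ ℤ.1ℤ)
  * sum +-0-rawMonoid {suc (((n ℕ.+ 1) ∸ (k ℕ.+ l)) ⊓ (m ∸ l))}
      (λ s → summand l m n (toℕ s))

{-# OPTIONS --safe #-}
-- Once the run has parked, the occupied spots form a block of length l with a = k - 1
-- free spots before it and b = n - k - l + 1 after it. Whether cars can complete a
-- partial occupation is decided by room alone, suffix by suffix, so peeling off the first
-- spot of the street expresses the number of completions by r = m - l cars as the binomial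
-- transform of the count for the shorter street, cut off when the cars exceed the free
-- spots. With Q(c, t) = (c - t) c^(t-1), the binomial transform of Q(c, ·) is Q(c + 1, ·);
-- hence, by Abel's identity at a = 0 and induction on a, the count is
--   Σ_{s ≤ min(b, r)} C(r, s) Q(l + s, s) Q(a + b + 1 - s, r - s).
-- Its terms are positive and depend on k only through the range of summation.
module Submission where

open import Defs
open import Data.Integer.Base using (+_)
open import Data.Nat.Base using (ℕ; _≤_; _<_; _+_; _∸_)
open import Data.Product.Base using (_×_)
open import Relation.Binary.PropositionalEquality using (_≡_)

open import Algebra.Bundles using (module Ring)
open import Data.Bool.Base using (if_then_else_; true; false)
open import Data.Fin.Base using (Fin; zero; suc; toℕ; fromℕ<)
open import Data.Fin.Properties using (toℕ<n; toℕ-fromℕ<)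
open import Data.Fin.Subset using (Subset; inside; outside; ⊥)
import Data.Integer.Base as ℤ
import Data.Integer.Properties as ℤ
import Data.Integer.Tactic.RingSolver as ℤ-Solver
open import Data.List.Base
  using (List; []; _∷_; _++_; length; filter; map; tabulate; cartesianProductWith)
open import Data.List.Properties using (filter-++; filter-≐; filter-none; length-++)
import Data.List.Relation.Unary.All as All
open import Data.Maybe using (Is-just)
open import Data.Maybe.Base as Maybe using (Maybe; just; nothing; maybe′; _>>=_)
import Data.Maybe.Relation.Unary.Any as Any
open import Data.Nat.Base as ℕ using (zero; suc; _*_; _⊓_; z≤n; s≤s)
open import Data.Nat.Combinatorics using (_C_; nCk+nC[k+1]≡[n+1]C[k+1]; k>n⇒nCk≡0)
import Data.Nat.Coprimality as Coprime
open import Data.Nat.Properties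
open import Data.Nat.Tactic.RingSolver using (solve-∀)
open import Data.Product.Base using (_,_; proj₁; proj₂)
open import Data.Rational.Base as ℚ using (ℚ; mkℚ)
import Data.Rational.Properties as ℚ
open import Data.Rational.Solver using () renaming (module +-*-Solver to ℚ-Solver)
open import Data.Sum.Base using (inj₁; inj₂)
open import Data.Unit.Base using (tt)
open import Data.Vec.Base using (Vec; []; _∷_)
open import Function.Base using (_∘_)
open import Level using (0ℓ)
open import Relation.Binary.PropositionalEquality
  using (_≢_; refl; sym; trans; cong; cong₂; subst; module ≡-Reasoning)
open import Relation.Nullary using (¬_; contradiction)
open import Relation.Nullary.Decidable using (does; yes; no; dec-true; dec-false; _×-dec_)
open import Relation.Unary using (Pred; Decidable; _≐_)

open import Algebra.Properties.CommutativeMonoid.Sum +-0-commutativeMonoid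
  using (sum; ∑-distrib-+; sum-cong-≗; sum-replicate-zero)
open import Algebra.Properties.CommutativeSemigroup +-commutativeSemigroup
  using (interchange; x∙yz≈y∙xz; xy∙z≈xz∙y)
import Algebra.Properties.Semiring.Sum (Ring.semiring ℚ.+-*-ring) as ℚ-Sum
open ≡-Reasoning

-- Binomial transforms and binomial convolutions.

-- binomial f t is the sum of C(t, i) f(i) over i ≤ t, by Pascal's rule.
binomial : (ℕ → ℕ) → ℕ → ℕ
binomial f zero    = f 0
binomial f (suc t) = binomial f t + binomial (f ∘ suc) t

binomial-cong : ∀ {f g} t → (∀ i → i ≤ t → f i ≡ g i) → binomial f t ≡ binomial g t
binomial-cong zero    f≗g = f≗g 0 z≤n
binomial-cong (suc t) f≗g = cong₂ _+_
  (binomial-cong t λ i i≤t → f≗g i (m≤n⇒m≤1+n i≤t))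
  (binomial-cong t λ i i≤t → f≗g (suc i) (s≤s i≤t))

binomial-zero : ∀ t → binomial (λ _ → 0) t ≡ 0
binomial-zero zero    = refl
binomial-zero (suc t) = cong₂ _+_ (binomial-zero t) (binomial-zero t)

binomial-+ : ∀ f g t → binomial (λ i → f i + g i) t ≡ binomial f t + binomial g t
binomial-+ f g zero    = refl
binomial-+ f g (suc t) = trans
  (cong₂ _+_ (binomial-+ f g t) (binomial-+ (f ∘ suc) (g ∘ suc) t))
  (interchange (binomial f t) _ _ _)

binomial-* : ∀ a f t → binomial (λ i → a * f i) t ≡ a * binomial f t
binomial-* a f zero    = refl
binomial-* a f (suc t) = trans
  (cong₂ _+_ (binomial-* a f t) (binomial-* a (f ∘ suc) t))
  (sym (*-distribˡ-+ a (binomial f t) _))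

binomial-sum : ∀ {n} (f : Fin n → ℕ → ℕ) t →
  sum (λ p → binomial (f p) t) ≡ binomial (λ j → sum (λ p → f p j)) t
binomial-sum f zero    = refl
binomial-sum f (suc t) = trans
  (∑-distrib-+ (λ p → binomial (f p) t) (λ p → binomial (f p ∘ suc) t))
  (cong₂ _+_ (binomial-sum f t) (binomial-sum (λ p → f p ∘ suc) t))

-- convolution h r is the sum of C(r, s) h(s, r - s) over s ≤ r, by Pascal's rule.
convolution : (ℕ → ℕ → ℕ) → ℕ → ℕ
convolution h zero    = h 0 0
convolution h (suc r) = convolution (h ∘ suc) r + convolution (λ s → h s ∘ suc) r

convolution-cong : ∀ {f g} r → (∀ s t → s + t ≡ r → f s t ≡ g s t) →
  convolution f r ≡ convolution g r
convolution-cong zero    f≗g = f≗g 0 0 refl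
convolution-cong (suc r) f≗g = cong₂ _+_
  (convolution-cong r λ s t eq → f≗g (suc s) t (cong suc eq))
  (convolution-cong r λ s t eq → f≗g s (suc t) (trans (+-suc s t) (cong suc eq)))

convolution-zero : ∀ {f} r → (∀ s t → s + t ≡ r → f s t ≡ 0) → convolution f r ≡ 0
convolution-zero zero    f≗0 = f≗0 0 0 refl
convolution-zero (suc r) f≗0 = cong₂ _+_
  (convolution-zero r λ s t eq → f≗0 (suc s) t (cong suc eq))
  (convolution-zero r λ s t eq → f≗0 s (suc t) (trans (+-suc s t) (cong suc eq)))

convolution-last : ∀ {f} r → (∀ s t → s + suc t ≡ r → f s (suc t) ≡ 0) →
  convolution f r ≡ f r 0
convolution-last     zero    f≗0 = refl
convolution-last {f} (suc r) f≗0 = trans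
  (cong₂ _+_
    (convolution-last r λ s t eq → f≗0 (suc s) t (cong suc eq))
    (convolution-zero r λ s t eq → f≗0 s t (trans (+-suc s t) (cong suc eq))))
  (+-identityʳ (f (suc r) 0))

-- Choosing j of r cars and then s of those j amounts to choosing s first and then j - s of the
-- other r - s: C(r, j) C(j, s) = C(r, s) C(r - s, j - s). So the transform acts on the second
-- argument alone. With both operations defined by Pascal's rule, induction on r suffices.
binomial-convolution : ∀ h r →
  binomial (convolution h) r ≡ convolution (binomial ∘ h) r
binomial-convolution h zero    = refl
binomial-convolution h (suc r) = begin
  binomial (convolution h) r + binomial (convolution h ∘ suc) r
    ≡⟨ cong₂ _+_ (binomial-convolution h r)
        (trans (binomial-+ (convolution (h ∘ suc)) (convolution (λ s → h s ∘ suc)) r)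
          (cong₂ _+_ (binomial-convolution (h ∘ suc) r)
                     (binomial-convolution (λ s → h s ∘ suc) r))) ⟩
  W (binomial ∘ h) + (W (binomial ∘ h ∘ suc) + W (λ s → binomial (h s ∘ suc)))
    ≡⟨ x∙yz≈y∙xz (W (binomial ∘ h)) (W (binomial ∘ h ∘ suc)) _ ⟩
  W (binomial ∘ h ∘ suc) + (W (binomial ∘ h) + W (λ s → binomial (h s ∘ suc)))
    ≡⟨ cong (λ x → W (binomial ∘ h ∘ suc) + x) (sym (convolution-+ (binomial ∘ h) _ r)) ⟩
  convolution (binomial ∘ h) (suc r) ∎
  where
  W : (ℕ → ℕ → ℕ) → ℕ
  W f = convolution f r
  convolution-+ : ∀ f g r →
    convolution (λ s t → f s t + g s t) r ≡ convolution f r + convolution g r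
  convolution-+ f g zero    = refl
  convolution-+ f g (suc r) = trans
    (cong₂ _+_ (convolution-+ (f ∘ suc) (g ∘ suc) r)
               (convolution-+ (λ s → f s ∘ suc) (λ s → g s ∘ suc) r))
    (interchange (convolution (f ∘ suc) r) _ _ _)

-- Pollak's numbers and Abel's identity.

-- Pollak's count (c - t) c^(t-1) of the parking functions with t cars and c - 1 spots.
pollak : ℕ → ℕ → ℕ
pollak c zero    = 1
pollak c (suc t) = (c ∸ suc t) * c ℕ.^ t

pollak-diagonal : ∀ t → pollak (suc t) (suc t) ≡ 0
pollak-diagonal t = cong (_* suc t ℕ.^ t) (n∸n≡0 (suc t))

power : ℕ → ℕ → ℕ
power c t = c ℕ.^ t

-- The derivative of c^t with respect to c. Pollak's number is c^t minus this, a difference stated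
-- below as a sum to stay within the natural numbers.
derivative : ℕ → ℕ → ℕ
derivative c zero    = 0
derivative c (suc t) = suc t * c ℕ.^ t

pollak+derivative : ∀ {c} t → t ≤ c → pollak c t + derivative c t ≡ power c t
pollak+derivative     zero    _   = refl
pollak+derivative {c} (suc t) t<c = begin
  (c ∸ suc t) * c ℕ.^ t + suc t * c ℕ.^ t ≡⟨ *-distribʳ-+ (c ℕ.^ t) (c ∸ suc t) (suc t) ⟨
  (c ∸ suc t + suc t) * c ℕ.^ t           ≡⟨ cong (_* c ℕ.^ t) (m∸n+n≡m t<c) ⟩
  c * c ℕ.^ t                             ∎

binomial-power : ∀ c t → binomial (power c) t ≡ power (suc c) t
binomial-power c zero    = refl
binomial-power c (suc t) = cong₂ _+_ (binomial-power c t)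
  (trans (binomial-* c (power c) t) (cong (c *_) (binomial-power c t)))

-- This is the binomial theorem for (c + 1)^t differentiated in c; the induction runs on the product
-- rule for c * c^i.
binomial-derivative : ∀ c t → binomial (derivative c) t ≡ derivative (suc c) t
binomial-derivative c zero    = refl
binomial-derivative c (suc t) = begin
  B (derivative c) + B (derivative c ∘ suc)
    ≡⟨ cong₂ _+_ (binomial-derivative c t)
        (trans (binomial-cong t λ i _ → product-rule c i)
          (trans (binomial-+ (power c) _ t)
            (cong₂ _+_ (binomial-power c t)
              (trans (binomial-* c (derivative c) t) (cong (c *_) (binomial-derivative c t)))))) ⟩
  derivative (suc c) t + (power (suc c) t + c * derivative (suc c) t)
    ≡⟨ rearrange (derivative (suc c) t) _ c ⟩
  power (suc c) t + suc c * derivative (suc c) t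
    ≡⟨ product-rule (suc c) t ⟨
  derivative (suc c) (suc t) ∎
  where
  B : (ℕ → ℕ) → ℕ
  B f = binomial f t
  rearrange : ∀ d p c → d + (p + c * d) ≡ p + suc c * d
  rearrange = solve-∀
  assoc-comm : ∀ a c p → a * (c * p) ≡ c * (a * p)
  assoc-comm = solve-∀
  product-rule : ∀ c i → derivative c (suc i) ≡ power c i + c * derivative c i
  product-rule c zero    = cong suc (sym (*-zeroʳ c))
  product-rule c (suc i) = cong (λ x → power c (suc i) + x) (assoc-comm (suc i) c (c ℕ.^ i))

-- By linearity: the transform raises c by one both in c^t and in its derivative, hence in their
-- difference. The bound t ≤ c keeps truncated subtraction exact.
binomial-pollak : ∀ {c} t → t ≤ c → binomial (pollak c) t ≡ pollak (suc c) t
binomial-pollak {c} t t≤c = +-cancelʳ-≡ (derivative (suc c) t) _ _ (begin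
  B (pollak c) + derivative (suc c) t       ≡⟨ cong (λ x → B (pollak c) + x) (binomial-derivative c t) ⟨
  B (pollak c) + B (derivative c)           ≡⟨ binomial-+ (pollak c) (derivative c) t ⟨
  B (λ i → pollak c i + derivative c i)     ≡⟨ binomial-cong t (λ i i≤t → pollak+derivative i (≤-trans i≤t t≤c)) ⟩
  B (power c)                               ≡⟨ binomial-power c t ⟩
  power (suc c) t                           ≡⟨ pollak+derivative t (m≤n⇒m≤1+n t≤c) ⟨
  pollak (suc c) t + derivative (suc c) t   ∎)
  where
  B : (ℕ → ℕ) → ℕ
  B f = binomial f t

-- The induction step common to Abel's identity and to the count for a block: for fixed s,
-- transforming in t raises d by one.
binomial-scaled-pollak : ∀ a {d} s t → s + t ≤ d →
  binomial (λ i → a * pollak (d ∸ s) i) t ≡ a * pollak (suc d ∸ s) t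
binomial-scaled-pollak a {d} s t s+t≤d = begin
  binomial (λ i → a * pollak (d ∸ s) i) t ≡⟨ binomial-* a (pollak (d ∸ s)) t ⟩
  a * binomial (pollak (d ∸ s)) t         ≡⟨ cong (a *_) (binomial-pollak t t≤d∸s) ⟩
  a * pollak (suc (d ∸ s)) t              ≡⟨ cong (λ c → a * pollak c t) (∸-suc (≤-trans (m≤m+n s t) s+t≤d)) ⟨
  a * pollak (suc d ∸ s) t                ∎
  where
  t≤d∸s : t ≤ d ∸ s
  t≤d∸s = m+n≤o⇒m≤o∸n t (subst (_≤ d) (+-comm s t) s+t≤d)
  ∸-suc : ∀ {m n} → m ≤ n → suc n ∸ m ≡ suc (n ∸ m)
  ∸-suc = +-∸-assoc 1

pollak-vanishes : ∀ {d} s t → s + suc t ≡ d → pollak (d ∸ s) (suc t) ≡ 0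
pollak-vanishes s t refl = trans
  (cong (λ c → pollak c (suc t)) (m+n∸m≡n s (suc t))) (pollak-diagonal t)

-- Raising d by one applies the binomial transform to either side, so it suffices to compare them at d = r,
-- where all terms but s = r vanish.
abel : ∀ l {d} r → r ≤ d →
  convolution (λ s t → pollak (l + s) s * pollak (d ∸ s) t) r ≡ pollak (l + d) r
abel l {d} r r≤d with m≤n⇒m<n∨m≡n r≤d
... | inj₂ refl = trans
  (convolution-last r λ s t eq → trans (cong (pollak (l + s) s *_) (pollak-vanishes s t eq)) (*-zeroʳ (pollak (l + s) s)))
  (*-identityʳ (pollak (l + r) r))
abel l {suc d} r _ | inj₁ (s≤s r≤d) = begin
  convolution (λ s t → pollak (l + s) s * pollak (suc d ∸ s) t) r
    ≡⟨ convolution-cong r (λ s t eq → sym (binomial-scaled-pollak (pollak (l + s) s) s t (≤-trans (≤-reflexive eq) r≤d))) ⟩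
  convolution (binomial ∘ term) r
    ≡⟨ binomial-convolution term r ⟨
  binomial (convolution term) r
    ≡⟨ binomial-cong r (λ j j≤r → abel l j (≤-trans j≤r r≤d)) ⟩
  binomial (pollak (l + d)) r
    ≡⟨ binomial-pollak r (≤-trans r≤d (m≤n+m d l)) ⟩
  pollak (suc (l + d)) r
    ≡⟨ cong (λ c → pollak c r) (+-suc l d) ⟨
  pollak (l + suc d) r ∎
  where
  term : ℕ → ℕ → ℕ
  term s t = pollak (l + s) s * pollak (d ∸ s) t

-- Completions of a partially occupied street.

free : ∀ {n} → Subset n → ℕ
free []              = 0
free (outside ∷ occ) = suc (free occ)
free (inside  ∷ occ) = free occ

-- The number of preference sequences of r further cars that all park. The binomial
-- transform sums over the number of cars preferring a spot after the first; the others
-- cause no failure as long as there is room for everybody.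
completions : ∀ {n} → Subset n → ℕ → ℕ
completions []            zero    = 1
completions []            (suc _) = 0
completions occ@(_ ∷ occ′) r      =
  if does (r ≤? free occ) then binomial (completions occ′) r else 0

completionsAfter : ∀ {n} → ℕ → Maybe (Subset n) → ℕ
completionsAfter r = maybe′ (λ occ → completions occ r) 0

completions-fit : ∀ {n} x (occ : Subset n) {r} → r ≤ free (x ∷ occ) →
  completions (x ∷ occ) r ≡ binomial (completions occ) r
completions-fit x occ {r} r≤free rewrite dec-true (r ≤? free (x ∷ occ)) r≤free = refl

completions-overfull : ∀ {n} (occ : Subset n) {r} → free occ < r → completions occ r ≡ 0
completions-overfull []        {suc r} _      = refl
completions-overfull (x ∷ occ) {r}     free<r
  rewrite dec-false (r ≤? free (x ∷ occ)) (<⇒≱ free<r) = refl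

free-park : ∀ {n} (occ : Subset n) p {occ′} → park occ p ≡ just occ′ → free occ ≡ suc (free occ′)
free-park (outside ∷ occ)     zero    refl = refl
free-park (inside ∷ y ∷ occ)  zero    eq   with park (y ∷ occ) zero in parked
free-park (inside ∷ y ∷ occ)  zero    refl | just _ = free-park (y ∷ occ) zero parked
free-park (x ∷ occ)           (suc p) eq   with park occ p in parked
free-park (outside ∷ occ)     (suc p) refl | just _ = cong suc (free-park occ p parked)
free-park (inside ∷ occ)      (suc p) refl | just _ = free-park occ p parked

completionsAfter-overfull : ∀ {n} (occ : Subset n) p {r} → free occ ≤ r →
  completionsAfter r (park occ p) ≡ 0
completionsAfter-overfull occ p free≤r with park occ p in parked
... | nothing   = refl
... | just occ′ = completions-overfull occ′ (≤-trans (≤-reflexive (sym (free-park occ p parked))) free≤r)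

-- While there is room, the first spot does not affect the transform of the remaining street. If it
-- is free, the car merely occupies it; otherwise the car drives on, and induction applies under the
-- transform.
park-first : ∀ {n} (occ : Subset (suc n)) {r} → r < free occ →
  completionsAfter r (park occ zero) ≡ completions occ r
park-first (outside ∷ occ) {r} (s≤s r≤free) = trans
  (completions-fit inside occ r≤free)
  (sym (completions-fit outside occ (m≤n⇒m≤1+n r≤free)))
park-first (inside ∷ occ@(y ∷ _)) {r} r<free
  -- The induction hypothesis is abstracted together with `park occ zero`, so that its type follows
  -- the case split.
  with park occ zero in parked | (λ {j} → park-first occ {j})
-- Here the induction hypothesis makes every term of the transform 0, and both sides vanish.
... | nothing   | ih = trans (sym (binomial-zero r)) (trans
  (binomial-cong r λ j j≤r → ih (≤-<-trans j≤r r<free))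
  (sym (completions-fit inside occ (<⇒≤ r<free))))
... | just occ′ | ih = begin
  completions (inside ∷ occ′) r ≡⟨ completions-fit inside occ′ r≤free′ ⟩
  binomial (completions occ′) r ≡⟨ binomial-cong r (λ j j≤r → ih (≤-<-trans j≤r r<free)) ⟩
  binomial (completions occ) r  ≡⟨ completions-fit inside occ (<⇒≤ r<free) ⟨
  completions (inside ∷ occ) r  ∎
  where
  r≤free′ : r ≤ free occ′
  r≤free′ = ≤-pred (≤-trans r<free (≤-reflexive (free-park occ zero parked)))

-- `completions` obeys the recursion on the next car's preference. Preferring the first spot gives
-- the transform of `completions occ′` at r, preferring a later one gives that of the shifted
-- sequence, and Pascal's rule adds them to the transform at r + 1.
completions-suc : ∀ {n} (occ : Subset n) r →
  sum (λ p → completionsAfter r (park occ p)) ≡ completions occ (suc r)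
completions-suc []        r = refl
completions-suc {suc n} occ@(x ∷ occ′) r with suc r ≤? free occ
... | no  r≮free = trans
  (trans (sum-cong-≗ λ p → completionsAfter-overfull occ p (≮⇒≥ r≮free))
         (sum-replicate-zero (suc n)))
  (sym (completions-overfull occ (≰⇒> r≮free)))
... | yes r<free = trans (cong₂ _+_
  (trans (park-first occ r<free) (completions-fit x occ′ (<⇒≤ r<free)))
  (begin
    sum (λ p → completionsAfter r (park occ (suc p)))
      ≡⟨ sum-cong-≗ (λ p → later (park occ′ p) λ eq → ≤-pred (≤-trans r<free (≤-reflexive (free-park occ (suc p) eq)))) ⟩
    sum (λ p → binomial (λ j → completionsAfter j (park occ′ p)) r)
      ≡⟨ binomial-sum (λ p j → completionsAfter j (park occ′ p)) r ⟩
    binomial (λ j → sum (λ p → completionsAfter j (park occ′ p))) r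
      ≡⟨ binomial-cong r (λ j _ → completions-suc occ′ j) ⟩
    binomial (completions occ′ ∘ suc) r ∎))
  (sym (completions-fit x occ′ r<free))
  where
  later : (parked : Maybe (Subset n)) →
    (∀ {occ″} → Maybe.map (x ∷_) parked ≡ just occ″ → r ≤ free occ″) →
    completionsAfter r (Maybe.map (x ∷_) parked) ≡ binomial (λ j → completionsAfter j parked) r
  later nothing     _    = sym (binomial-zero r)
  later (just occ″) room = completions-fit x occ″ (room refl)

-- Completions around a block of occupied spots.

-- The spots a, …, a + l - 1 (from 0) are occupied.
block : ℕ → ℕ → (n : ℕ) → Subset n
block a       l       zero    = []
block (suc a) l       (suc n) = outside ∷ block a l n
block zero    (suc l) (suc n) = inside ∷ block zero l n
block zero    zero    (suc n) = outside ∷ block zero zero n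

free-block : ∀ a l b → free (block a l (a + (l + b))) ≡ a + b
free-block (suc a) l       b       = cong suc (free-block a l b)
free-block zero    (suc l) b       = free-block zero l b
free-block zero    zero    zero    = refl
free-block zero    zero    (suc b) = cong suc (free-block zero zero b)

-- Each spot applies one transform. The range reaches r = b + 1, one car too many, because the step
-- to a longer street uses the shorter street at that value; there both sides vanish.
completions-empty : ∀ b r → r ≤ suc b → completions (block 0 0 b) r ≡ pollak (suc b) r
completions-empty zero    zero       _          = refl
completions-empty zero    (suc zero) _          = refl
completions-empty zero    (suc (suc _)) (s≤s ())
completions-empty (suc b) r          r≤ with m≤n⇒m<n∨m≡n r≤
... | inj₁ (s≤s r≤1+b) = begin
  completions (block 0 0 (suc b)) r   ≡⟨ completions-fit outside (block 0 0 b) (≤-trans r≤1+b (≤-reflexive (sym (free-block 0 0 (suc b))))) ⟩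
  binomial (completions (block 0 0 b)) r ≡⟨ binomial-cong r (λ j j≤r → completions-empty b j (≤-trans j≤r r≤1+b)) ⟩
  binomial (pollak (suc b)) r         ≡⟨ binomial-pollak r r≤1+b ⟩
  pollak (suc (suc b)) r              ∎
... | inj₂ refl = trans
  (completions-overfull (block 0 0 (suc b)) (s≤s (≤-reflexive (free-block 0 0 (suc b)))))
  (sym (pollak-diagonal (suc b)))

-- An occupied first spot leaves the room unchanged, so each of the l spots simply transforms once
-- more and raises the first argument of `pollak` by one.
completions-prefix : ∀ l b r → r ≤ b →
  completions (block 0 l (l + b)) r ≡ pollak (suc (l + b)) r
completions-prefix zero    b r r≤b = completions-empty b r (m≤n⇒m≤1+n r≤b)
completions-prefix (suc l) b r r≤b = begin
  completions (block 0 (suc l) (suc l + b)) r ≡⟨ completions-fit inside (block 0 l (l + b)) (≤-trans r≤b (≤-reflexive (sym (free-block 0 l b)))) ⟩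
  binomial (completions (block 0 l (l + b))) r ≡⟨ binomial-cong r (λ j j≤r → completions-prefix l b j (≤-trans j≤r r≤b)) ⟩
  binomial (pollak (suc (l + b))) r           ≡⟨ binomial-pollak r (m≤n⇒m≤1+n (≤-trans r≤b (m≤n+m b l))) ⟩
  pollak (suc (suc (l + b))) r                ∎

truncate : ℕ → (ℕ → ℕ → ℕ) → ℕ → ℕ → ℕ
truncate b h s t = if does (s ≤? b) then h s t else 0

truncate-≤ : ∀ {b s} h t → s ≤ b → truncate b h s t ≡ h s t
truncate-≤ {b} {s} h t s≤b rewrite dec-true (s ≤? b) s≤b = refl

truncate-> : ∀ {b s} h t → b < s → truncate b h s t ≡ 0
truncate-> {b} {s} h t b<s rewrite dec-false (s ≤? b) (<⇒≱ b<s) = refl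

-- With d free spots and s + t = r the factors are l (l + s)^(s-1) and (d + 1 - r) (d + 1 -
-- s)^(t-1).
blockTerm : ℕ → ℕ → ℕ → ℕ → ℕ
blockTerm l d s t = pollak (l + s) s * pollak (suc d ∸ s) t

-- With one car more than free spots, every term with t > 0 has a second factor on the diagonal of
-- `pollak`, which is 0. The one term with t = 0 has s = d + 1 > b and is cut off.
truncate-diagonal : ∀ l {d} b → b ≤ d →
  convolution (truncate b (blockTerm l d)) (suc d) ≡ 0
truncate-diagonal l {d} b b≤d = convolution-zero (suc d) vanishes
  where
  vanishes : ∀ s t → s + t ≡ suc d → truncate b (blockTerm l d) s t ≡ 0
  vanishes s t       eq with s ≤? b
  vanishes s t       eq | no  s≰b = truncate-> (blockTerm l d) t (≰⇒> s≰b)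
  vanishes s zero    eq | yes s≤b = contradiction
    (≤-trans (≤-reflexive (trans (sym eq) (+-identityʳ s))) (≤-trans s≤b b≤d)) 1+n≰n
  vanishes s (suc t) eq | yes s≤b = trans
    (truncate-≤ (blockTerm l d) (suc t) s≤b) (trans
    (cong (pollak (l + s) s *_) (pollak-vanishes s t eq)) (*-zeroʳ (pollak (l + s) s)))

-- Induction on a. Each free spot before the block transforms in t only, so the cut-off at s ≤ b
-- persists while d grows. The value r = a + b + 1 is included for the next step, and both sides are
-- 0 there.
completions-block : ∀ a l b r → r ≤ suc (a + b) →
  completions (block a l (a + (l + b))) r ≡ convolution (truncate b (blockTerm l (a + b))) r
completions-block a l b r r≤ with m≤n⇒m<n∨m≡n r≤
... | inj₂ refl = trans
  (completions-overfull (block a l (a + (l + b))) (s≤s (≤-reflexive (free-block a l b))))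
  (sym (truncate-diagonal l b (m≤n+m b a)))
completions-block zero l b r _ | inj₁ (s≤s r≤b) = begin
  completions (block 0 l (l + b)) r              ≡⟨ completions-prefix l b r r≤b ⟩
  pollak (suc (l + b)) r                         ≡⟨ cong (λ c → pollak c r) (+-suc l b) ⟨
  pollak (l + suc b) r                           ≡⟨ abel l r (m≤n⇒m≤1+n r≤b) ⟨
  convolution (blockTerm l b) r                  ≡⟨ convolution-cong r untruncated ⟩
  convolution (truncate b (blockTerm l b)) r     ∎
  where
  -- For a = 0 there are at most b cars, so s ≤ r ≤ b and the cut-off removes nothing.
  untruncated : ∀ s t → s + t ≡ r → blockTerm l b s t ≡ truncate b (blockTerm l b) s t
  untruncated s t refl = sym (truncate-≤ (blockTerm l b) t (≤-trans (m≤m+n s t) r≤b))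
completions-block (suc a) l b r _ | inj₁ (s≤s r≤) = begin
  completions (block (suc a) l (suc a + (l + b))) r
    ≡⟨ completions-fit outside (block a l (a + (l + b))) (≤-trans r≤ (≤-reflexive (cong suc (sym (free-block a l b))))) ⟩
  binomial (completions (block a l (a + (l + b)))) r
    ≡⟨ binomial-cong r (λ j j≤r → completions-block a l b j (≤-trans j≤r r≤)) ⟩
  binomial (convolution (truncate b (blockTerm l (a + b)))) r
    ≡⟨ binomial-convolution (truncate b (blockTerm l (a + b))) r ⟩
  convolution (binomial ∘ truncate b (blockTerm l (a + b))) r
    ≡⟨ convolution-cong r step ⟩
  convolution (truncate b (blockTerm l (suc a + b))) r ∎
  where
  step : ∀ s t → s + t ≡ r →
    binomial (truncate b (blockTerm l (a + b)) s) t ≡ truncate b (blockTerm l (suc a + b)) s t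
  step s t eq with s ≤? b
  ... | yes s≤b = begin
    binomial (truncate b (blockTerm l (a + b)) s) t
      ≡⟨ binomial-cong t (λ i _ → truncate-≤ (blockTerm l (a + b)) i s≤b) ⟩
    binomial (blockTerm l (a + b) s) t
      ≡⟨ binomial-scaled-pollak (pollak (l + s) s) s t (≤-trans (≤-reflexive eq) r≤) ⟩
    blockTerm l (suc a + b) s t
      ≡⟨ truncate-≤ (blockTerm l (suc a + b)) t s≤b ⟨
    truncate b (blockTerm l (suc a + b)) s t ∎
  ... | no s≰b = trans
    (trans (binomial-cong t λ i _ → truncate-> (blockTerm l (a + b)) i (≰⇒> s≰b)) (binomial-zero t))
    (sym (truncate-> (blockTerm l (suc a + b)) t (≰⇒> s≰b)))

-- From Pascal's rule to explicit finite sums.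

-- Terms beyond r have coefficient 0, so any N > r will do. This freedom lets the two halves of the
-- recursion be expanded with N and N + 1 terms and then aligned.
convolution-sum : ∀ h r N → r < N →
  convolution h r ≡ sum {N} (λ i → (r C toℕ i) * h (toℕ i) (r ∸ toℕ i))
convolution-sum h zero    (suc N) _ = sym (trans
  (cong₂ _+_ (+-identityʳ (h 0 0)) (sum-replicate-zero N)) (+-identityʳ (h 0 0)))
convolution-sum h (suc r) (suc N) (s≤s r<N) = begin
  convolution (h ∘ suc) r + convolution (λ s → h s ∘ suc) r
    ≡⟨ cong₂ _+_ (convolution-sum (h ∘ suc) r N r<N)
                 (convolution-sum (λ s → h s ∘ suc) r (suc N) (m≤n⇒m≤1+n r<N)) ⟩
  sum {N} left + (head + sum {N} right)
    ≡⟨ x∙yz≈y∙xz (sum {N} left) head (sum {N} right) ⟩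
  head + (sum {N} left + sum {N} right)
    ≡⟨ cong (λ x → head + x) (∑-distrib-+ {N} left right) ⟨
  head + sum {N} (λ i → left i + right i)
    ≡⟨ cong (λ x → head + x) (sum-cong-≗ {N} (λ i → pascal (toℕ i))) ⟩
  head + sum {N} (λ i → (suc r C suc (toℕ i)) * h (suc (toℕ i)) (r ∸ toℕ i)) ∎
  where
  head : ℕ
  head = 1 * h 0 (suc r)
  left right : Fin N → ℕ
  left  i = (r C toℕ i) * h (suc (toℕ i)) (r ∸ toℕ i)
  right i = (r C suc (toℕ i)) * h (suc (toℕ i)) (suc (r ∸ suc (toℕ i)))
  -- For s ≥ r truncated subtraction breaks the identity between the arguments, but then C(r, s + 1)
  -- = 0.
  shift : ∀ s → (r C suc s) * h (suc s) (suc (r ∸ suc s)) ≡ (r C suc s) * h (suc s) (r ∸ s)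
  shift s with suc s ≤? r
  ... | yes s<r = cong (λ t → (r C suc s) * h (suc s) t) (sym (+-∸-assoc 1 s<r))
  ... | no  s≮r rewrite k>n⇒nCk≡0 (≰⇒> s≮r) = refl
  pascal : ∀ s → (r C s) * h (suc s) (r ∸ s) + (r C suc s) * h (suc s) (suc (r ∸ suc s))
             ≡ (suc r C suc s) * h (suc s) (r ∸ s)
  pascal s = begin
    (r C s) * h (suc s) (r ∸ s) + (r C suc s) * h (suc s) (suc (r ∸ suc s))
      ≡⟨ cong (λ x → (r C s) * h (suc s) (r ∸ s) + x) (shift s) ⟩
    (r C s) * h (suc s) (r ∸ s) + (r C suc s) * h (suc s) (r ∸ s)
      ≡⟨ *-distribʳ-+ (h (suc s) (r ∸ s)) (r C s) (r C suc s) ⟨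
    ((r C s) + (r C suc s)) * h (suc s) (r ∸ s)
      ≡⟨ cong (_* h (suc s) (r ∸ s)) (nCk+nC[k+1]≡[n+1]C[k+1] r s) ⟩
    (suc r C suc s) * h (suc s) (r ∸ s) ∎

sum-restrict : ∀ (f : ℕ → ℕ) {M N} → M ≤ N → (∀ s → M ≤ s → f s ≡ 0) →
  sum {N} (f ∘ toℕ) ≡ sum {M} (f ∘ toℕ)
sum-restrict f {N = N} z≤n f≗0 =
  trans (sum-cong-≗ {N} λ i → f≗0 (toℕ i) z≤n) (sum-replicate-zero N)
sum-restrict f (s≤s M≤N) f≗0 =
  cong (λ x → f 0 + x) (sum-restrict (f ∘ suc) M≤N λ s M≤s → f≗0 (suc s) (s≤s M≤s))

sum-mono-< : ∀ (f : ℕ → ℕ) {M N} → M < N → (∀ s → s < N → 0 < f s) →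
  sum {M} (f ∘ toℕ) < sum {N} (f ∘ toℕ)
sum-mono-< f {zero}  (s≤s _)   f>0 = ≤-trans (f>0 0 (s≤s z≤n)) (m≤m+n (f 0) _)
sum-mono-< f {suc M} (s≤s M<N) f>0 =
  +-monoʳ-< (f 0) (sum-mono-< (f ∘ suc) M<N λ s s<N → f>0 (suc s) (s≤s s<N))

sum-single : ∀ {n} (f : Fin n → ℕ) i → (∀ j → toℕ j ≢ toℕ i → f j ≡ 0) → sum f ≡ f i
sum-single {suc n} f zero    f≗0 = trans
  (cong (λ x → f zero + x) (trans (sum-cong-≗ λ j → f≗0 (suc j) λ ()) (sum-replicate-zero n)))
  (+-identityʳ (f zero))
sum-single         f (suc i) f≗0 = cong₂ _+_ (f≗0 zero λ ())
  (sum-single (f ∘ suc) i λ j j≢i → f≗0 (suc j) (j≢i ∘ suc-injective))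

-- The term of the formula with the leading factor n - m + 1 included: that factor comes from the
-- second `pollak` and does not depend on s.
summandℕ : (l m n s : ℕ) → ℕ
summandℕ l m n s = ((m ∸ l) C s) * blockTerm l (n ∸ l) s (m ∸ l ∸ s)

completions-block-sum : ∀ a l b r → r ≤ a + b →
  completions (block a l (a + (l + b))) r ≡
  sum {suc (b ⊓ r)} (λ i → (r C toℕ i) * blockTerm l (a + b) (toℕ i) (r ∸ toℕ i))
completions-block-sum a l b r r≤ = begin
  completions (block a l (a + (l + b))) r      ≡⟨ completions-block a l b r (m≤n⇒m≤1+n r≤) ⟩
  convolution (truncate b h) r                 ≡⟨ convolution-sum (truncate b h) r (suc r) ≤-refl ⟩
  sum {suc r} (truncated ∘ toℕ)                ≡⟨ sum-restrict truncated (s≤s (m⊓n≤n b r)) vanishes ⟩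
  sum {suc (b ⊓ r)} (truncated ∘ toℕ)          ≡⟨ sum-cong-≗ (λ i → cong ((r C toℕ i) *_) (truncate-≤ h (r ∸ toℕ i) (≤-trans (≤-pred (toℕ<n i)) (m⊓n≤m b r)))) ⟩
  sum {suc (b ⊓ r)} (λ i → (r C toℕ i) * h (toℕ i) (r ∸ toℕ i)) ∎
  where
  h : ℕ → ℕ → ℕ
  h = blockTerm l (a + b)
  truncated : ℕ → ℕ
  truncated s = (r C s) * truncate b h s (r ∸ s)
  vanishes : ∀ s → suc (b ⊓ r) ≤ s → truncated s ≡ 0
  vanishes s b⊓r<s with s ≤? b
  ... | no  s≰b = trans (cong ((r C s) *_) (truncate-> h (r ∸ s) (≰⇒> s≰b))) (*-zeroʳ (r C s))
  ... | yes s≤b with s ≤? r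
  ...   | yes s≤r = contradiction (⊓-glb s≤b s≤r) (<⇒≱ b⊓r<s)
  ...   | no  s≰r rewrite k>n⇒nCk≡0 (≰⇒> s≰r) = refl

-- Counting sequences by their first entry.

module _ {A : Set} {P : Pred A 0ℓ} (P? : Decidable P) where

  length-filter-map : ∀ {B : Set} (f : B → A) xs →
    length (filter P? (map f xs)) ≡ length (filter (P? ∘ f) xs)
  length-filter-map f []       = refl
  length-filter-map f (x ∷ xs) with does (P? (f x))
  ... | true  = cong suc (length-filter-map f xs)
  ... | false = length-filter-map f xs

  length-filter-cartesianProductWith : ∀ {n} {B C : Set} (f : B → C → A) (g : Fin n → B) ys →
    length (filter P? (cartesianProductWith f (tabulate g) ys)) ≡
    sum (λ i → length (filter (P? ∘ f (g i)) ys))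
  length-filter-cartesianProductWith {zero}  f g ys = refl
  length-filter-cartesianProductWith {suc n} f g ys = begin
    length (filter P? (map (f (g zero)) ys ++ rest))
      ≡⟨ cong length (filter-++ P? (map (f (g zero)) ys) rest) ⟩
    length (filter P? (map (f (g zero)) ys) ++ filter P? rest)
      ≡⟨ length-++ (filter P? (map (f (g zero)) ys)) ⟩
    length (filter P? (map (f (g zero)) ys)) + length (filter P? rest)
      ≡⟨ cong₂ _+_ (length-filter-map (f (g zero)) ys)
                   (length-filter-cartesianProductWith f (g ∘ suc) ys) ⟩
    sum (λ i → length (filter (P? ∘ f (g i)) ys)) ∎
    where
    rest : List A
    rest = cartesianProductWith f (tabulate (g ∘ suc)) ys

count-∷ : ∀ {m n} {P : Pred (Vec (Fin n) (suc m)) 0ℓ} (P? : Decidable P) →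
  count P? ≡ sum (λ p → count (λ π → P? (p ∷ π)))
count-∷ {m} {n} P? = length-filter-cartesianProductWith P? _∷_ (λ i → i) (sequences m n)

count-≐ : ∀ {m n} {P Q : Pred (Vec (Fin n) m) 0ℓ} (P? : Decidable P) (Q? : Decidable Q) →
  P ≐ Q → count P? ≡ count Q?
count-≐ {m} {n} P? Q? P≐Q = cong length (filter-≐ P? Q? P≐Q (sequences m n))

count-none : ∀ {m n} {P : Pred (Vec (Fin n) m) 0ℓ} (P? : Decidable P) →
  (∀ π → ¬ P π) → count P? ≡ 0
count-none {m} {n} P? ¬P =
  cong length (filter-none P? {sequences m n} (All.universal ¬P (sequences m n)))

parksAfter? : ∀ {m n} (parked : Maybe (Subset n)) →
  Decidable {A = Vec (Fin n) m} (λ π → Is-just (parked >>= λ occ → parkAll occ π))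
parksAfter? parked π = Any.dec (λ _ → yes tt) (parked >>= λ occ → parkAll occ π)

completions-zero : ∀ {n} (occ : Subset n) → completions occ 0 ≡ 1
completions-zero []        = refl
completions-zero (x ∷ occ) = completions-zero occ

-- Stated for a possibly failed state, since after the first preference the induction continues from
-- `park occ p`.
count-parksAfter : ∀ m {n} (parked : Maybe (Subset n)) →
  count {m} (parksAfter? parked) ≡ completionsAfter m parked
count-parksAfter m       nothing    = count-none {m} (parksAfter? nothing) λ _ ()
count-parksAfter zero    (just occ) = sym (completions-zero occ)
count-parksAfter (suc m) (just occ) = begin
  count (parksAfter? {suc m} (just occ))            ≡⟨ count-∷ (parksAfter? (just occ)) ⟩
  sum (λ p → count (parksAfter? {m} (park occ p)))  ≡⟨ sum-cong-≗ (λ p → count-parksAfter m (park occ p)) ⟩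
  sum (λ p → completionsAfter m (park occ p))       ≡⟨ completions-suc occ m ⟩
  completions occ (suc m)                           ∎

-- Parking the run.

park-block : ∀ a i n (p : Fin n) → toℕ p ≡ a + i → park (block a i n) p ≡ just (block a (suc i) n)
park-block (suc a) i       (suc n) (suc p) eq =
  cong (Maybe.map (outside ∷_)) (park-block a i n p (suc-injective eq))
park-block zero    (suc i) (suc n) (suc p) eq =
  cong (Maybe.map (inside ∷_)) (park-block zero i n p (suc-injective eq))
park-block zero    zero    (suc n) zero    eq = refl

block-empty : ∀ a n → block a 0 n ≡ ⊥
block-empty a       zero    = refl
block-empty zero    (suc n) = cong (outside ∷_) (block-empty zero n)
block-empty (suc a) (suc n) = cong (outside ∷_) (block-empty a n)

startsWithRun-∷ : ∀ {m n} l k (p : Fin n) (π : Vec (Fin n) m) → suc (toℕ p) ≡ k →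
  (StartsWithRun (suc l) k (p ∷ π) → StartsWithRun l (suc k) π) ×
  (StartsWithRun l (suc k) π → StartsWithRun (suc l) k (p ∷ π))
startsWithRun-∷ l k p π eq = tail , cons
  where
  tail : StartsWithRun (suc l) k (p ∷ π) → StartsWithRun l (suc k) π
  tail run i i<l = trans (run (suc i) (s≤s i<l)) (+-suc k (toℕ i))
  cons : StartsWithRun l (suc k) π → StartsWithRun (suc l) k (p ∷ π)
  cons run zero    _         = trans eq (sym (+-identityʳ k))
  cons run (suc i) (s≤s i<l) = trans (run i i<l) (sym (+-suc k (toℕ i)))

parksWithRun? : ∀ m {n} (occ : Subset n) l k → Decidable {A = Vec (Fin n) m}
  (λ π → Is-just (parkAll occ π) × StartsWithRun l k π)
parksWithRun? m occ l k π = parksAfter? (just occ) π ×-dec startsWithRun? l k π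

-- Here i cars of the run have parked, l remain, and k is the 0-based spot of the next one. The run
-- condition admits a single preference for it; that spot is free, so the block grows by one. After
-- the run, `completions` counts the rest.
count-run : ∀ l r n a i k → k ≡ a + i → k + l ≤ n →
  count (parksWithRun? (l + r) (block a i n) l (suc k)) ≡
  completions (block a (i + l) n) r
count-run zero r n a i k eq _ = begin
  count (parksWithRun? r (block a i n) 0 (suc k))
    ≡⟨ count-≐ (parksWithRun? r (block a i n) 0 (suc k)) (parksAfter? (just (block a i n))) (proj₁ , λ parks → parks , λ _ ()) ⟩
  count (parksAfter? {r} (just (block a i n)))
    ≡⟨ count-parksAfter r (just (block a i n)) ⟩
  completions (block a i n) r
    ≡⟨ cong (λ j → completions (block a j n) r) (+-identityʳ i) ⟨
  completions (block a (i + 0) n) r ∎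
count-run (suc l) r n a i k eq k+l<n = begin
  count P?
    ≡⟨ count-∷ P? ⟩
  sum (λ p → count (λ π → P? (p ∷ π)))
    ≡⟨ sum-single (λ p → count (λ π → P? (p ∷ π))) q (λ p p≢q → count-none (λ π → P? (p ∷ π)) λ π (_ , run) →
        p≢q (trans (suc-injective (trans (run zero (s≤s z≤n)) (+-identityʳ (suc k)))) (sym q≡k))) ⟩
  count (λ π → P? (q ∷ π))
    ≡⟨ count-≐ (λ π → P? (q ∷ π)) (parksWithRun? (l + r) (block a (suc i) n) l (suc (suc k)))
        ( (λ {π} (parks , run) → subst (Parks π) parked parks , proj₁ (startsWithRun-∷ l (suc k) q π (cong suc q≡k)) run)
        , (λ {π} (parks , run) → subst (Parks π) (sym parked) parks , proj₂ (startsWithRun-∷ l (suc k) q π (cong suc q≡k)) run)) ⟩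
  count (parksWithRun? (l + r) (block a (suc i) n) l (suc (suc k)))
    ≡⟨ count-run l r n a (suc i) (suc k) (trans (cong suc eq) (sym (+-suc a i)))
        (≤-trans (≤-reflexive (sym (+-suc k l))) k+l<n) ⟩
  completions (block a (suc i + l) n) r
    ≡⟨ cong (λ j → completions (block a j n) r) (+-suc i l) ⟨
  completions (block a (i + suc l) n) r ∎
  where
  P? : Decidable {A = Vec (Fin n) (suc (l + r))}
    (λ π → Is-just (parkAll (block a i n) π) × StartsWithRun (suc l) (suc k) π)
  P? = parksWithRun? (suc (l + r)) (block a i n) (suc l) (suc k)
  k<n : k < n
  k<n = ≤-trans (s≤s (m≤m+n k l)) (≤-trans (≤-reflexive (sym (+-suc k l))) k+l<n)
  q : Fin n
  q = fromℕ< k<n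
  q≡k : toℕ q ≡ k
  q≡k = toℕ-fromℕ< k<n
  Parks : Vec (Fin n) (l + r) → Maybe (Subset n) → Set
  Parks π parked = Is-just (parked >>= λ occ → parkAll occ π)
  parked : park (block a i n) q ≡ just (block a (suc i) n)
  parked = park-block a i n q (trans q≡k eq)

#PF-block : ∀ l r n a → a + l ≤ n → #PF l (l + r) n (suc a) ≡ completions (block a l n) r
#PF-block l r n a a+l≤n = trans
  (cong (λ occ → count (parksWithRun? (l + r) occ l (suc a)))
    (sym (block-empty a n)))
  (count-run l r n a 0 a (sym (+-identityʳ a)) a+l≤n)

-- Passage to the rational formula.

-- The fraction n / 1 in lowest terms, on which rational arithmetic computes; `fromℤ` normalises by
-- a gcd that is stuck on a variable.
integral : ℕ → ℚ
integral n = mkℚ (+ n) 0 (Coprime.sym (Coprime.1-coprimeTo n))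

fromℕ : ℕ → ℚ
fromℕ n = fromℤ (+ n)

fromℕ≡integral : ∀ n → fromℕ n ≡ integral n
fromℕ≡integral n = ℚ.normalize-coprime (Coprime.sym (Coprime.1-coprimeTo n))

fromℕ-+ : ∀ a b → fromℕ (a + b) ≡ fromℕ a ℚ.+ fromℕ b
fromℕ-+ a b = begin
  fromℕ (a + b)             ≡⟨ cong (ℚ._/ 1) (cong₂ ℤ._+_ (ℤ.*-identityʳ (+ a)) (ℤ.*-identityʳ (+ b))) ⟨
  integral a ℚ.+ integral b ≡⟨ cong₂ ℚ._+_ (fromℕ≡integral a) (fromℕ≡integral b) ⟨
  fromℕ a ℚ.+ fromℕ b       ∎

fromℕ-* : ∀ a b → fromℕ (a * b) ≡ fromℕ a ℚ.* fromℕ b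
fromℕ-* a b = begin
  fromℕ (a * b)             ≡⟨ cong (ℚ._/ 1) (ℤ.pos-* a b) ⟩
  integral a ℚ.* integral b ≡⟨ cong₂ ℚ._*_ (fromℕ≡integral a) (fromℕ≡integral b) ⟨
  fromℕ a ℚ.* fromℕ b       ∎

fromℕ-^ : ∀ a e → fromℕ (a ℕ.^ e) ≡ fromℕ a ^ (+ e)
fromℕ-^ a zero    = refl
fromℕ-^ a (suc e) = trans (fromℕ-* a (a ℕ.^ e)) (cong (fromℕ a ℚ.*_) (fromℕ-^ a e))

fromℕ-sum : ∀ n (f : Fin n → ℕ) → fromℕ (sum f) ≡ ℚ-Sum.sum (fromℕ ∘ f)
fromℕ-sum zero    f = refl
fromℕ-sum (suc n) f = trans (fromℕ-+ (f zero) (sum (f ∘ suc)))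
  (cong (λ x → fromℕ (f zero) ℚ.+ x) (fromℕ-sum n (f ∘ suc)))

fromℕ-inverse : ∀ a → fromℕ (suc a) ℚ.* inv (fromℕ (suc a)) ≡ ℚ.1ℚ
fromℕ-inverse a rewrite fromℕ≡integral (suc a) = ℚ.*-inverseʳ (integral (suc a))

-- The base is written as d + 1 + t to avoid subtraction. At t = 0 the exponent is -1, and the right
-- side is (d + 1) times its inverse.
fromℕ-pollak : ∀ d t → fromℕ (pollak (suc d + t) t) ≡
  fromℕ (suc d) ℚ.* fromℕ (suc d + t) ^ (+ t ℤ.- ℤ.1ℤ)
fromℕ-pollak d zero    = sym (begin
  fromℕ (suc d) ℚ.* (inv (fromℕ (suc d + 0)) ℚ.* ℚ.1ℚ)
    ≡⟨ cong (fromℕ (suc d) ℚ.*_) (ℚ.*-identityʳ (inv (fromℕ (suc d + 0)))) ⟩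
  fromℕ (suc d) ℚ.* inv (fromℕ (suc d + 0))
    ≡⟨ cong (λ c → fromℕ (suc d) ℚ.* inv (fromℕ c)) (+-identityʳ (suc d)) ⟩
  fromℕ (suc d) ℚ.* inv (fromℕ (suc d))
    ≡⟨ fromℕ-inverse d ⟩
  ℚ.1ℚ ∎)
fromℕ-pollak d (suc t) = begin
  fromℕ ((c ∸ suc t) * c ℕ.^ t)          ≡⟨ fromℕ-* (c ∸ suc t) (c ℕ.^ t) ⟩
  fromℕ (c ∸ suc t) ℚ.* fromℕ (c ℕ.^ t)  ≡⟨ cong₂ ℚ._*_ (cong fromℕ (m+n∸n≡m (suc d) (suc t))) (fromℕ-^ c t) ⟩
  fromℕ (suc d) ℚ.* fromℕ c ^ (+ t)      ∎
  where
  c : ℕ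
  c = suc d + suc t

-- Setting m = l + s + t and n = m + d turns every difference in the formula into a sum of these
-- parameters.
module _ (l′ s t d : ℕ) where

  private
    l m n : ℕ
    l = suc l′
    m = l + (s + t)
    n = l + (s + t) + d

  lead : + n ℤ.- + m ℤ.+ ℤ.1ℤ ≡ + suc d
  lead = identity (+ m) (+ d)
    where
    identity : ∀ m d → m ℤ.+ d ℤ.- m ℤ.+ ℤ.1ℤ ≡ ℤ.1ℤ ℤ.+ d
    identity = ℤ-Solver.solve-∀

  base : + n ℤ.- + s ℤ.+ ℤ.1ℤ ℤ.- + l ≡ + (suc d + t)
  base = identity (+ l) (+ s) (+ t) (+ d)
    where
    identity : ∀ l s t d → l ℤ.+ (s ℤ.+ t) ℤ.+ d ℤ.- s ℤ.+ ℤ.1ℤ ℤ.- l ≡ ℤ.1ℤ ℤ.+ d ℤ.+ t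
    identity = ℤ-Solver.solve-∀

  exponent : + m ℤ.- + s ℤ.- + l ℤ.- ℤ.1ℤ ≡ + t ℤ.- ℤ.1ℤ
  exponent = identity (+ l) (+ s) (+ t)
    where
    identity : ∀ l s t → l ℤ.+ (s ℤ.+ t) ℤ.- s ℤ.- l ℤ.- ℤ.1ℤ ≡ t ℤ.- ℤ.1ℤ
    identity = ℤ-Solver.solve-∀

  fromℕ-summandℕ : fromℕ (summandℕ l m n s) ≡ fromℤ (+ n ℤ.- + m ℤ.+ ℤ.1ℤ) ℚ.* summand l m n s
  fromℕ-summandℕ = begin
    fromℕ (summandℕ l m n s)
      ≡⟨ cong fromℕ (cong₂ (λ r c → ((m ∸ l) C s) * (pollak (l + s) s * pollak c r)) m∸l∸s [n∸l]∸s) ⟩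
    fromℕ (((m ∸ l) C s) * (pollak (l + s) s * pollak (suc d + t) t))
      ≡⟨ fromℕ-* ((m ∸ l) C s) _ ⟩
    c ℚ.* fromℕ (pollak (l + s) s * pollak (suc d + t) t)
      ≡⟨ cong (c ℚ.*_) (fromℕ-* (pollak (l + s) s) _) ⟩
    c ℚ.* (fromℕ (pollak (l + s) s) ℚ.* fromℕ (pollak (suc d + t) t))
      ≡⟨ cong₂ (λ x y → c ℚ.* (x ℚ.* y)) (fromℕ-pollak l′ s) (fromℕ-pollak d t) ⟩
    c ℚ.* (fromℕ l ℚ.* y ℚ.* (fromℕ (suc d) ℚ.* x))
      ≡⟨ rearrange c (fromℕ l) y (fromℕ (suc d)) x ⟩
    fromℕ (suc d) ℚ.* (c ℚ.* x ℚ.* fromℕ l ℚ.* y)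
      ≡⟨ cong₂ ℚ._*_ (cong fromℤ lead) (cong₂ (λ x y → c ℚ.* x ℚ.* fromℕ l ℚ.* y)
          (cong₂ (λ b e → fromℤ b ^ e) base exponent)
          (cong (λ b → fromℕ b ^ (+ s ℤ.- ℤ.1ℤ)) (+-comm s l))) ⟨
    fromℤ (+ n ℤ.- + m ℤ.+ ℤ.1ℤ) ℚ.* summand l m n s ∎
    where
    c x y : ℚ
    c = fromℕ ((m ∸ l) C s)
    x = fromℕ (suc d + t) ^ (+ t ℤ.- ℤ.1ℤ)
    y = fromℕ (l + s) ^ (+ s ℤ.- ℤ.1ℤ)
    m∸l∸s : m ∸ l ∸ s ≡ t
    m∸l∸s = trans (cong (_∸ s) (m+n∸m≡n l (s + t))) (m+n∸m≡n s t)
    [n∸l]∸s : suc (n ∸ l) ∸ s ≡ suc d + t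
    [n∸l]∸s = begin
      suc (n ∸ l) ∸ s         ≡⟨ cong (λ k → suc (k ∸ l) ∸ s) (+-assoc l (s + t) d) ⟩
      suc (l + (s + t + d) ∸ l) ∸ s ≡⟨ cong (λ k → suc k ∸ s) (m+n∸m≡n l (s + t + d)) ⟩
      suc (s + t + d) ∸ s     ≡⟨ cong (_∸ s) (shuffle s t d) ⟩
      s + (suc d + t) ∸ s     ≡⟨ m+n∸m≡n s (suc d + t) ⟩
      suc d + t               ∎
      where
      shuffle : ∀ s t d → suc (s + t + d) ≡ s + (suc d + t)
      shuffle = solve-∀
    rearrange : ∀ c l y d x → c ℚ.* (l ℚ.* y ℚ.* (d ℚ.* x)) ≡ d ℚ.* (c ℚ.* x ℚ.* l ℚ.* y)
    rearrange = ℚ-Solver.solve 5 (λ c l y d x →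
      c ℚ-Solver.:* (l ℚ-Solver.:* y ℚ-Solver.:* (d ℚ-Solver.:* x)) ℚ-Solver.:= d ℚ-Solver.:* (c ℚ-Solver.:* x ℚ-Solver.:* l ℚ-Solver.:* y)) refl

sumℕ : (l m n k : ℕ) → ℕ
sumℕ l m n k = sum {suc (((n + 1) ∸ (k + l)) ⊓ (m ∸ l))} (λ i → summandℕ l m n (toℕ i))

fromℕ-sumℕ : ∀ {l m n} k → 1 ≤ l → l ≤ m → m ≤ n → fromℕ (sumℕ l m n k) ≡ formula l m n k
fromℕ-sumℕ {l@(suc l′)} {m} {n} k _ l≤m m≤n = begin
  fromℕ (sumℕ l m n k)
    ≡⟨ fromℕ-sum (suc N) (λ i → summandℕ l m n (toℕ i)) ⟩
  ℚ-Sum.sum {suc N} (λ i → fromℕ (summandℕ l m n (toℕ i)))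
    ≡⟨ ℚ-Sum.sum-cong-≗ {suc N} (λ i → termwise (toℕ i) (≤-trans (≤-pred (toℕ<n i)) (m⊓n≤n _ (m ∸ l)))) ⟩
  ℚ-Sum.sum {suc N} (λ i → a ℚ.* summand l m n (toℕ i))
    ≡⟨ ℚ-Sum.*-distribˡ-sum {suc N} a (λ i → summand l m n (toℕ i)) ⟨
  formula l m n k ∎
  where
  N : ℕ
  N = ((n + 1) ∸ (k + l)) ⊓ (m ∸ l)
  a : ℚ
  a = fromℤ (+ n ℤ.- + m ℤ.+ ℤ.1ℤ)
  termwise : ∀ s → s ≤ m ∸ l →
    fromℕ (summandℕ l m n s) ≡ a ℚ.* summand l m n s
  termwise s s≤m∸l
    with m≤n⇒∃[o]m+o≡n l≤m | m≤n⇒∃[o]m+o≡n m≤n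
  ... | r , refl | d , refl with m≤n⇒∃[o]m+o≡n (subst (s ≤_) (m+n∸m≡n l r) s≤m∸l)
  ... | t , refl = fromℕ-summandℕ l′ s t d

-- The count as a sum of natural numbers.

#PF≡sumℕ : ∀ {l m n k} → l ≤ m → m ≤ n → 1 ≤ k → k ≤ n ∸ l + 1 → #PF l m n k ≡ sumℕ l m n k
#PF≡sumℕ {l} {m} {n} {suc a} l≤m m≤n _ k≤ with m≤n⇒∃[o]m+o≡n l≤m | m≤n⇒∃[o]m+o≡n a+l≤n
  where
  a+l≤n : a + l ≤ n
  a+l≤n = m≤o∸n⇒m+n≤o a (≤-trans l≤m m≤n) (≤-pred (≤-trans k≤ (≤-reflexive (+-comm (n ∸ l) 1))))
... | r , refl | b , refl = begin
  #PF l (l + r) (a + l + b) (suc a)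
    ≡⟨ #PF-block l r (a + l + b) a (m≤m+n (a + l) b) ⟩
  completions (block a l (a + l + b)) r
    ≡⟨ cong (λ n → completions (block a l n) r) (+-assoc a l b) ⟩
  completions (block a l (a + (l + b))) r
    ≡⟨ completions-block-sum a l b r (+-cancelˡ-≤ l _ _ (≤-trans m≤n (≤-reflexive split))) ⟩
  sum {suc (b ⊓ r)} (λ i → (r C toℕ i) * blockTerm l (a + b) (toℕ i) (r ∸ toℕ i))
    ≡⟨ cong₂ (λ r′ d → sum {suc (b ⊓ r)} (λ i → (r′ C toℕ i) * blockTerm l d (toℕ i) (r′ ∸ toℕ i)))
        (sym (m+n∸m≡n l r)) (sym (trans (cong (_∸ l) split) (m+n∸m≡n l (a + b)))) ⟩
  sum {suc (b ⊓ r)} (λ i → summandℕ l (l + r) (a + l + b) (toℕ i))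
    -- Since k = a + 1, the extra 1 in (n + 1) ∸ (k + l) cancels and b remains.
    ≡⟨ cong₂ (λ b′ r′ → sum {suc (b′ ⊓ r′)} (λ i → summandℕ l (l + r) (a + l + b) (toℕ i)))
        (sym (trans (cong (_∸ suc (a + l)) (+-comm (a + l + b) 1)) (m+n∸m≡n (a + l) b)))
        (sym (m+n∸m≡n l r)) ⟩
  sumℕ l (l + r) (a + l + b) (suc a) ∎
  where
  split : a + l + b ≡ l + (a + b)
  split = trans (cong (_+ b) (+-comm a l)) (+-assoc l a b)

-- Positivity of the terms and dependence on k.

pollak-positive : ∀ {c} t → t < c → 0 < pollak c t
pollak-positive     zero    _     = s≤s z≤n
pollak-positive {c} (suc t) 1+t<c = *-mono-< {0} {_} {0} (m<n⇒0<n∸m 1+t<c)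
  (m^n>0 c {{ℕ.>-nonZero (≤-trans (s≤s z≤n) 1+t<c)}} t)

C-positive : ∀ {n k} → k ≤ n → 0 < n C k
C-positive {n}     {zero}  _         = s≤s z≤n
C-positive {suc n} {suc k} (s≤s k≤n) = ≤-trans
  (C-positive k≤n)
  (≤-trans (m≤m+n (n C k) (n C suc k)) (≤-reflexive (nCk+nC[k+1]≡[n+1]C[k+1] n k)))

-- Both `pollak` factors lie strictly below the diagonal: s < l + s because l ≥ 1, and m - l - s < n
-- - l + 1 - s because m ≤ n.
summandℕ-positive : ∀ {l m n s} → 1 ≤ l → m ≤ n → s ≤ m ∸ l → 0 < summandℕ l m n s
summandℕ-positive {l} {m} {n} {s} 1≤l m≤n s≤m∸l = *-mono-< {0} {_} {0} (C-positive s≤m∸l)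
  (*-mono-< {0} {_} {0} (pollak-positive s (+-monoˡ-≤ s 1≤l))
    (pollak-positive (m ∸ l ∸ s) (≤-trans (s≤s (∸-monoˡ-≤ s (∸-monoˡ-≤ l m≤n)))
      (≤-reflexive (sym (+-∸-assoc 1 (≤-trans s≤m∸l (∸-monoˡ-≤ l m≤n))))))))

proposition2p7 : (l m n : ℕ) → 1 ≤ l → l ≤ m → m ≤ n →
    ((k : ℕ) → 1 ≤ k → k ≤ n ∸ l + 1 →
    fromℤ (+ #PF l m n k) ≡ formula l m n k)
    × ((k k′ : ℕ) → 1 ≤ k → k ≤ n ∸ m + 1 → 1 ≤ k′ → k′ ≤ n ∸ m + 1 →
    #PF l m n k ≡ #PF l m n k′)
    × ((k k′ : ℕ) → n ∸ m + 1 ≤ k → k < k′ → k′ ≤ n ∸ l + 1 →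
    #PF l m n k′ < #PF l m n k)
proposition2p7 l m n 1≤l l≤m m≤n = count-formula , constant , decreasing
  where
  count-formula : ∀ k → 1 ≤ k → k ≤ n ∸ l + 1 → fromℤ (+ #PF l m n k) ≡ formula l m n k
  count-formula k 1≤k k≤ = trans
    (cong fromℕ (#PF≡sumℕ l≤m m≤n 1≤k k≤)) (fromℕ-sumℕ k 1≤l l≤m m≤n)

  n∸m+1+m≡n+1 : n ∸ m + 1 + m ≡ n + 1
  n∸m+1+m≡n+1 = trans (xy∙z≈xz∙y (n ∸ m) 1 m) (cong (_+ 1) (m∸n+n≡m m≤n))

  #PF≡total : ∀ k → 1 ≤ k → k ≤ n ∸ m + 1 →
    #PF l m n k ≡ sum {suc (m ∸ l)} (λ i → summandℕ l m n (toℕ i))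
  #PF≡total k 1≤k k≤ = trans
    (#PF≡sumℕ l≤m m≤n 1≤k (≤-trans k≤ (+-monoˡ-≤ 1 (∸-monoʳ-≤ n l≤m))))
    -- For k ≤ n - m + 1 we have n + 1 - (k + l) ≥ m - l, so the minimum is m - l for all such k.
    (cong (λ N → sum {suc N} (λ i → summandℕ l m n (toℕ i)))
      (m≥n⇒m⊓n≡n (≤-trans (≤-reflexive (sym ([m+n]∸[m+o]≡n∸o k m l)))
        (∸-monoˡ-≤ (k + l) (≤-trans (+-monoˡ-≤ m k≤) (≤-reflexive n∸m+1+m≡n+1))))))

  constant : ∀ k k′ → 1 ≤ k → k ≤ n ∸ m + 1 → 1 ≤ k′ → k′ ≤ n ∸ m + 1 →
    #PF l m n k ≡ #PF l m n k′
  constant k k′ 1≤k k≤ 1≤k′ k′≤ = trans (#PF≡total k 1≤k k≤) (sym (#PF≡total k′ 1≤k′ k′≤))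

  decreasing : ∀ k k′ → n ∸ m + 1 ≤ k → k < k′ → k′ ≤ n ∸ l + 1 → #PF l m n k′ < #PF l m n k
  decreasing k k′ ≤k k<k′ k′≤
    rewrite #PF≡sumℕ {k = k} l≤m m≤n (≤-trans (m≤n+m 1 (n ∸ m)) ≤k) (≤-trans (<⇒≤ k<k′) k′≤)
          | #PF≡sumℕ {k = k′} l≤m m≤n (≤-trans (s≤s z≤n) k<k′) k′≤
    = sum-mono-< (summandℕ l m n) (s≤s b′⊓r<b⊓r)
        (λ s s≤b⊓r → summandℕ-positive 1≤l m≤n (≤-trans (≤-pred s≤b⊓r) (m⊓n≤n b (m ∸ l))))
    where
    b b′ : ℕ
    b  = n + 1 ∸ (k + l)
    b′ = n + 1 ∸ (k′ + l)
    -- From k = n - m + 1 on, the minimum is b itself, so a larger k drops positive terms.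
    b≤m∸l : b ≤ m ∸ l
    b≤m∸l = ≤-trans
      (∸-monoˡ-≤ (k + l) (≤-trans (≤-reflexive (sym n∸m+1+m≡n+1)) (+-monoˡ-≤ m ≤k)))
      (≤-reflexive ([m+n]∸[m+o]≡n∸o k m l))
    -- This keeps the truncated subtraction strictly decreasing between k and k′.
    k′+l≤n+1 : k′ + l ≤ n + 1
    k′+l≤n+1 = ≤-trans (+-monoˡ-≤ l k′≤) (≤-reflexive
      (trans (xy∙z≈xz∙y (n ∸ l) 1 l) (cong (_+ 1) (m∸n+n≡m (≤-trans l≤m m≤n)))))
    b′⊓r<b⊓r : b′ ⊓ (m ∸ l) < b ⊓ (m ∸ l)
    b′⊓r<b⊓r = ≤-trans
      (s≤s (m⊓n≤m b′ (m ∸ l)))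
      (≤-trans (∸-monoʳ-< (+-monoˡ-< l k<k′) k′+l≤n+1) (≤-reflexive (sym (m≤n⇒m⊓n≡m b≤m∸l))))
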